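{- If $G$ is a Hamiltonian graph on $5$ or more vertices, then $G^3$ is $5$-ordered Hamiltonian.
   Context: All graphs are finite simple graphs. $d_G(v,w)$ denotes the distance in $G$ between vertices $v$ and $w$. For a positive integer $n$, the $n$-th power $G^n$ of a graph $G$ is the simple graph with the same vertex set as $G$ in which two distinct vertices $v,w$ are adjacent if and only if $d_G(v,w)\leq n$. A graph is Hamiltonian if it has a cycle through all its vertices. A graph $G$ is $k$-ordered Hamiltonian if for any sequence $v_1,v_2,\dots,v_k$ of $k$ distinct vertices of $G$ there is a Hamiltonian cycle in $G$ containing these vertices in the given order, i.e. traversing the cycle from $v_1$ in one of its two directions, one meets $v_1,v_2,\dots,v_k$ in this order before returning to $v_1$. -}

module Defs where

open import Data.Fin using (Fin)
open import Data.Fin.Properties using (_≟_; any?)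
open import Data.List using (List; _∷_; _∷ʳ_; length)
open import Data.List.Membership.Propositional using (_∈_)
open import Data.List.Relation.Binary.Sublist.Propositional using (_⊆_)
open import Data.List.Relation.Unary.Linked using (Linked)
open import Data.List.Relation.Unary.Unique.Propositional using (Unique)
open import Data.Nat using (ℕ; zero; suc; _≤_; _<_; s≤s)
open import Data.Nat.Properties using (anyUpTo?; allUpTo?; ≮⇒≥; <⇒≱; ≤-pred)
open import Data.Product using (∃-syntax; _×_; _,_)
open import Level using (0ℓ)
open import Relation.Binary.Core using (Rel)
open import Relation.Binary.Definitions using (Symmetric; Irreflexive; Decidable)
open import Relation.Binary.PropositionalEquality using (_≡_; _≢_; refl; ≢-sym)
open import Relation.Nullary using (¬_)
open import Relation.Nullary.Decidable using (map′; ¬?; _×-dec_)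

-- Decidability of adjacency makes this the usual classical notion of a
-- finite simple graph (a symmetric 0/1 matrix with zero diagonal).
record Graph (n : ℕ) : Set₁ where
  field
    Adj    : Rel (Fin n) 0ℓ
    sym    : Symmetric Adj
    irrefl : Irreflexive _≡_ Adj
    adj?   : Decidable Adj

open Graph public

data Walk {n} (G : Graph n) : Fin n → Fin n → ℕ → Set where
  nil  : ∀ {u} → Walk G u u 0
  cons : ∀ {u v w k} → Adj G u v → Walk G v w k → Walk G u w (suc k)

-- Distance G u w d  means  d_G(u,w) = d.  It is a relation since d_G(u,w) is
-- infinite, i.e. no d qualifies, when u and w lie in different components.
Distance : ∀ {n} → Graph n → Fin n → Fin n → ℕ → Set
Distance G u w d = Walk G u w d × (∀ {e} → Walk G u w e → d ≤ e)

snoc : ∀ {n} {G : Graph n} {u v w k} →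
       Walk G u v k → Adj G v w → Walk G u w (suc k)
snoc nil        b = cons b nil
snoc (cons a p) b = cons a (snoc p b)

reverseWalk : ∀ {n} {G : Graph n} {u w k} → Walk G u w k → Walk G w u k
reverseWalk         nil        = nil
reverseWalk {G = G} (cons a p) = snoc (reverseWalk p) (sym G a)

distance-sym : ∀ {n} {G : Graph n} {u w d} → Distance G u w d → Distance G w u d
distance-sym (p , min) = reverseWalk p , λ q → min (reverseWalk q)

walk? : ∀ {n} (G : Graph n) k → Decidable (λ u w → Walk G u w k)
walk? G zero u w = map′ (λ { refl → nil }) (λ { nil → refl }) (u ≟ w)
walk? G (suc k) u w =
  map′ (λ { (v , a , p) → cons a p }) (λ { (cons a p) → _ , a , p })
       (any? (λ v → adj? G u v ×-dec walk? G k v w))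

distance? : ∀ {n} (G : Graph n) d → Decidable (λ u w → Distance G u w d)
distance? G d u w =
  map′ to from (walk? G d u w ×-dec allUpTo? (λ e → ¬? (walk? G e u w)) d)
  where
  NoShorter : Set
  NoShorter = ∀ {e} → e < d → ¬ Walk G u w e

  to : Walk G u w d × NoShorter → Distance G u w d
  to (p , none) = p , λ q → ≮⇒≥ (λ e<d → none e<d q)

  from : Distance G u w d → Walk G u w d × NoShorter
  from (p , min) = p , λ e<d q → <⇒≱ e<d (min q)

power : ∀ {n} → Graph n → ℕ → Graph n
power G k .Adj v w = v ≢ w × ∃[ d ] (Distance G v w d × d ≤ k)
power G k .sym (v≢w , d , dist , d≤k) = ≢-sym v≢w , d , distance-sym dist , d≤k
power G k .irrefl v≡w (v≢w , _) = v≢w v≡w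
power G k .adj? v w =
  ¬? (v ≟ w) ×-dec
  map′ (λ { (d , d<1+k , dist) → d , dist , ≤-pred d<1+k })
       (λ { (d , dist , d≤k) → d , s≤s d≤k , dist })
       (anyUpTo? (λ d → distance? G d v w) (suc k))

-- A cycle together with a starting vertex and a direction of traversal: from
-- v one meets the vertices of ws in turn and then returns to v.  Every cycle
-- has such a presentation for each of its vertices and both directions.
record IsCycle {n} (G : Graph n) (v : Fin n) (ws : List (Fin n)) : Set where
  field
    long     : 3 ≤ length (v ∷ ws)
    distinct : Unique (v ∷ ws)
    closed   : Linked (Adj G) (v ∷ (ws ∷ʳ v))

IsHamiltonianCycle : ∀ {n} → Graph n → Fin n → List (Fin n) → Set
IsHamiltonianCycle G v ws = IsCycle G v ws × (∀ u → u ∈ v ∷ ws)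

Hamiltonian : ∀ {n} → Graph n → Set
Hamiltonian G = ∃[ v ] ∃[ ws ] IsHamiltonianCycle G v ws

-- The sequence is v ∷ vs (so k is positive).  The choice of direction is part
-- of the choice of ws, and the order-preserving sublist relation vs ⊆ ws says
-- that the rest of the sequence is met in order before returning to v.
OrderedHamiltonian : ∀ {n} → ℕ → Graph n → Set
OrderedHamiltonian k G =
  ∀ v vs → length (v ∷ vs) ≡ k → Unique (v ∷ vs) →
  ∃[ ws ] (IsHamiltonianCycle G v ws × vs ⊆ ws)

{-# OPTIONS --safe #-}

-- Cut the given Hamiltonian cycle at the five prescribed vertices.  Up to
-- rotating and reversing both cycles, the prescribed cyclic order arises from
-- the order s₀ s₁ s₂ s₃ s₄ along the given cycle in one of four ways: it is the
-- same order, it swaps s₃ and s₄, it swaps s₀ with s₁ and s₂ with s₃, or it is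
-- the pentagram s₀ s₂ s₄ s₁ s₃.  Two neighbours s, s′ are swapped by going once
-- around the given cycle and crossing the stretch from s to s′ three times: on
-- to s′, back to s, and on again, each crossing using every third vertex.  The
-- pentagram goes around twice, the two laps sharing the vertices of each stretch
-- nearly alternately.
module Submission where

open import Defs
import Algebra.Solver.CommutativeMonoid as CommutativeMonoidSolver
open import Data.Empty using (⊥-elim)
open import Data.Fin using (Fin; zero; suc)
open import Data.Fin.Patterns using (0F; 1F; 2F; 3F)
open import Data.List using (List; []; _∷_; _++_; insertAt; length)
open import Data.List.Membership.Propositional using (_∈_; _∉_)
open import Data.List.Membership.Propositional.Properties using (∈-∃++)
open import Data.List.Properties using (++-identityʳ)
open import Data.List.Relation.Binary.Permutation.Propositional
  using (_↭_; ↭-refl; ↭-sym; ↭-trans; ↭⇒↭ₛ; prep; swap; module PermutationReasoning)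
open import Data.List.Relation.Binary.Permutation.Propositional.Properties
  using (++⁺; ++⁺ˡ; ++⁺ʳ; ++-comm; shift; ∈-resp-↭; ++-commutativeMonoid)
import Data.List.Relation.Binary.Permutation.Setoid.Properties as PermutationSetoid
open import Data.List.Relation.Binary.Sublist.Propositional using (_⊆_; []; _∷_; _∷ʳ_; from∈; minimum)
open import Data.List.Relation.Binary.Sublist.Propositional.Properties using (length-mono-≤)
  renaming (++⁺ˡ to skip)
open import Data.List.Relation.Unary.All using ([]; _∷_)
open import Data.List.Relation.Unary.All.Properties using (All¬⇒¬Any)
open import Data.List.Relation.Unary.AllPairs using ([]; _∷_)
open import Data.List.Relation.Unary.Any using (here; there)
open import Data.List.Relation.Unary.Linked using (Linked; [-]; _∷_)
open import Data.List.Relation.Unary.Unique.Propositional using (Unique)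
open import Data.Nat using (ℕ; suc; _+_; _≤_; _<_; z≤n; s≤s)
open import Data.Nat.Induction using (<-rec)
open import Data.Nat.Properties using (≤-refl; ≤-trans; <⇒≤; ≮⇒≥; +-mono-≤; anyUpTo?)
open import Data.Product using (∃-syntax; _×_; _,_)
open import Data.Sum using (_⊎_; inj₁; inj₂)
open import Level using (0ℓ)
open import Relation.Binary.Core using (Rel; _⇒_)
open import Relation.Binary.Definitions using (Symmetric)
open import Relation.Binary.PropositionalEquality using (_≡_; _≢_; refl; subst; setoid)
  renaming (sym to ≡-sym)
open import Relation.Nullary using (yes; no)

-- Sublists, paths, and closed walks through five vertices.

module _ {V : Set} where

  private variable
    R S : Rel V 0ℓ
    I X Y : List V
    a b c d e u v w : V

  insertAt-↭ : ∀ (xs : List V) i x → insertAt xs i x ↭ x ∷ xs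
  insertAt-↭ xs       zero    x = ↭-refl
  insertAt-↭ (y ∷ xs) (suc i) x = ↭-trans (prep y (insertAt-↭ xs i x)) (swap y x ↭-refl)

  unique-↭ : X ↭ Y → Unique X → Unique Y
  unique-↭ X↭Y = PermutationSetoid.Unique-resp-↭ (setoid _) (↭⇒↭ₛ X↭Y)

  ∈-tail : u ∈ v ∷ X → v ≢ u → u ∈ X
  ∈-tail (here u≡v)  v≢u = ⊥-elim (v≢u (≡-sym u≡v))
  ∈-tail (there u∈X) _   = u∈X

  -- Adding the prescribed vertices one by one keeps them listed as the given cycle meets them; the
  -- position `i` records this order for `reorder`.
  insertAt-⊆ : u ∈ Y → u ∉ X → X ⊆ Y → ∃[ i ] insertAt X i u ⊆ Y
  insertAt-⊆ (here refl) _   (_ ∷ʳ s)   = zero , refl ∷ s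
  insertAt-⊆ (here refl) u∉X (refl ∷ _) = ⊥-elim (u∉X (here refl))
  insertAt-⊆ (there u∈Y) u∉X (y ∷ʳ s)   = let i , s′ = insertAt-⊆ u∈Y u∉X s in i , y ∷ʳ s′
  insertAt-⊆ (there u∈Y) u∉X (refl ∷ s) =
    let i , s′ = insertAt-⊆ u∈Y (λ u∈X → u∉X (there u∈X)) s in suc i , refl ∷ s′

  -- The list holds the interior vertices only, so that the paths making up a
  -- closed walk share no list entries.
  data Path (R : Rel V 0ℓ) : V → List V → V → Set where
    edge : ∀ {u v} → R u v → Path R u [] v
    _∷_  : ∀ {u v w X} → R u v → Path R v X w → Path R u (v ∷ X) w

  infixr 5 _▹_

  _▹_ : Path R u X v → Path R v Y w → Path R u (X ++ v ∷ Y) w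
  edge r  ▹ q = r ∷ q
  (r ∷ p) ▹ q = r ∷ (p ▹ q)

  mapPath : R ⇒ S → Path R u X v → Path S u X v
  mapPath f (edge r) = edge (f r)
  mapPath f (r ∷ p)  = f r ∷ mapPath f p

  splitPath : ∀ X → Path R u (X ++ v ∷ Y) w → Path R u X v × Path R v Y w
  splitPath []      (r ∷ p) = edge r , p
  splitPath (_ ∷ X) (r ∷ p) = let p₁ , p₂ = splitPath X p in r ∷ p₁ , p₂

  backwards : Symmetric R → Path R u X v → ∃[ X′ ] (X′ ↭ X × Path R v X′ u)
  backwards R-sym (edge r) = [] , ↭-refl , edge (R-sym r)
  backwards R-sym (_∷_ {v = x} r p) =
    let X′ , X′↭X , p′ = backwards R-sym p in
    X′ ++ x ∷ [] , ↭-trans (++-comm X′ _) (prep x X′↭X) , p′ ▹ edge (R-sym r)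

  linked⇒path : ∀ X → Linked R (u ∷ X ++ v ∷ []) → Path R u X v
  linked⇒path []      (r ∷ _) = edge r
  linked⇒path (_ ∷ X) (r ∷ l) = r ∷ linked⇒path X l

  path⇒linked : Path R u X v → Linked R (u ∷ X ++ v ∷ [])
  path⇒linked (edge r) = r ∷ [-]
  path⇒linked (r ∷ p)  = r ∷ path⇒linked p

  path-distinct : Unique (u ∷ X) → v ∉ u ∷ X → Path R u X v → Path (λ x y → x ≢ y × R x y) u X v
  path-distinct _ v∉ (edge r) = edge ((λ { refl → v∉ (here refl) }) , r)
  path-distinct ((u≢x ∷ _) ∷ uniq) v∉ (r ∷ p) =
    (u≢x , r) ∷ path-distinct uniq (λ v∈ → v∉ (there v∈)) p

  -- A closed walk through a, b, c, d, e in this order; I lists its other vertices,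
  -- in any order.
  record Tour (R : Rel V 0ℓ) (I : List V) (a b c d e : V) : Set where
    constructor tour
    field
      {A B C D E} : List V
      path₁    : Path R a A b
      path₂    : Path R b B c
      path₃    : Path R c C d
      path₄    : Path R d D e
      path₅    : Path R e E a
      interior : A ++ B ++ C ++ D ++ E ↭ I

  tour⇒path : Tour R I a b c d e →
    ∃[ X ] (X ↭ b ∷ c ∷ d ∷ e ∷ I × b ∷ c ∷ d ∷ e ∷ [] ⊆ X × Path R a X a)
  tour⇒path {b = b} {c = c} {d = d} {e = e} (tour {A} {B} {C} {D} {E} p q r s t i) =
    A ++ b ∷ B ++ c ∷ C ++ d ∷ D ++ e ∷ E ,
    ↭-trans (solve 9 (λ A B C D E b c d e →
        A ⊕ (b ⊕ B) ⊕ (c ⊕ C) ⊕ (d ⊕ D) ⊕ e ⊕ E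
      ⊜ b ⊕ c ⊕ d ⊕ e ⊕ A ⊕ B ⊕ C ⊕ D ⊕ E) ↭-refl
      A B C D E (b ∷ []) (c ∷ []) (d ∷ []) (e ∷ []))
      (++⁺ˡ (b ∷ c ∷ d ∷ e ∷ []) i) ,
    skip A (refl ∷ skip B (refl ∷ skip C (refl ∷ skip D (refl ∷ minimum E)))) ,
    (p ▹ q ▹ r ▹ s ▹ t)
    where open CommutativeMonoidSolver (++-commutativeMonoid {A = V})

  -- Unlike in `Tour`, the number of stops is left open, so that `route` can proceed by induction
  -- along the path.
  data Route (R : Rel V 0ℓ) : List V → V → List V → V → Set where
    last : Path R u X w → Route R X u [] w
    _∷_  : Path R u X v → Route R Y v I w → Route R (X ++ Y) u (v ∷ I) w

  delay : R u v → Route R X v Y w → Route R (v ∷ X) u Y w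
  delay r (last p) = last (r ∷ p)
  delay r (p ∷ ps) = (r ∷ p) ∷ ps

  route : Path R u X w → Y ⊆ X → ∃[ I ] (X ↭ Y ++ I × Route R I u Y w)
  route (edge r) []         = [] , ↭-refl , last (edge r)
  route {Y = Y} (r ∷ p) (x ∷ʳ s) =
    let I , X↭ , ps = route p s in x ∷ I , ↭-trans (prep x X↭) (↭-sym (shift x Y I)) , delay r ps
  route (r ∷ p) (refl ∷ s)  = let I , X↭ , ps = route p s in I , prep _ X↭ , edge r ∷ ps

  route⇒tour : Route R I a (b ∷ c ∷ d ∷ e ∷ []) a → Tour R I a b c d e
  route⇒tour (p ∷ q ∷ r ∷ s ∷ last t) = tour p q r s t ↭-refl

  rotate : Tour R I a b c d e → Tour R I b c d e a
  rotate (tour {A} {B} {C} {D} {E} p q r s t i) = tour q r s t p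
    (↭-trans (solve 5 (λ A B C D E → B ⊕ C ⊕ D ⊕ E ⊕ A ⊜ A ⊕ B ⊕ C ⊕ D ⊕ E) ↭-refl A B C D E) i)
    where open CommutativeMonoidSolver (++-commutativeMonoid {A = V})

  rotate² : Tour R I a b c d e → Tour R I c d e a b
  rotate² t = rotate (rotate t)

  rotate³ : Tour R I a b c d e → Tour R I d e a b c
  rotate³ t = rotate (rotate² t)

  rotate⁴ : Tour R I a b c d e → Tour R I e a b c d
  rotate⁴ t = rotate (rotate³ t)

  mirror : Symmetric R → Tour R I a b c d e → Tour R I a e d c b
  mirror R-sym (tour {A} {B} {C} {D} {E} p q r s t i)
    with A′ , A↭ , p′ ← backwards R-sym p
       | B′ , B↭ , q′ ← backwards R-sym q
       | C′ , C↭ , r′ ← backwards R-sym r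
       | D′ , D↭ , s′ ← backwards R-sym s
       | E′ , E↭ , t′ ← backwards R-sym t
    = tour t′ s′ r′ q′ p′ (begin
        E′ ++ D′ ++ C′ ++ B′ ++ A′  ↭⟨ ++⁺ E↭ (++⁺ D↭ (++⁺ C↭ (++⁺ B↭ A↭))) ⟩
        E ++ D ++ C ++ B ++ A       ↭⟨ solve 5 (λ A B C D E → E ⊕ D ⊕ C ⊕ B ⊕ A ⊜ A ⊕ B ⊕ C ⊕ D ⊕ E) ↭-refl A B C D E ⟩
        A ++ B ++ C ++ D ++ E       ↭⟨ i ⟩
        _                           ∎)
    where
    open CommutativeMonoidSolver (++-commutativeMonoid {A = V})
    open PermutationReasoning

-- Walks of bounded length and adjacency in the power.

Within : ∀ {n} → Graph n → ℕ → Rel (Fin n) 0ℓ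
Within G k u v = ∃[ j ] (j ≤ k × Walk G u v j)

module _ {n} {G : Graph n} where

  private variable
    j k : ℕ
    a b c d e u v w x y : Fin n
    I P Q X Y : List (Fin n)

  -- Walks of a given length are decidable: either a shorter walk is found, and strong induction
  -- applies, or the walk at hand is shortest.
  walk-distance : Walk G x y k → ∃[ l ] (Distance G x y l × l ≤ k)
  walk-distance {x} {y} {k} = <-rec (λ k → Walk G x y k → ∃[ l ] (Distance G x y l × l ≤ k)) shorten k
    where
    shorten : ∀ k → (∀ {j} → j < k → Walk G x y j → ∃[ l ] (Distance G x y l × l ≤ j)) →
              Walk G x y k → ∃[ l ] (Distance G x y l × l ≤ k)
    shorten k rec p with anyUpTo? (λ j → walk? G j x y) k
    ... | yes (j , j<k , q) = let l , dist , l≤j = rec j<k q in l , dist , ≤-trans l≤j (<⇒≤ j<k)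
    ... | no none = k , (p , λ q → ≮⇒≥ λ j<k → none (_ , j<k , q)) , ≤-refl

  _++ʷ_ : Walk G x y j → Walk G y u k → Walk G x u (j + k)
  nil      ++ʷ q = q
  cons a p ++ʷ q = cons a (p ++ʷ q)

  infixr 6 _then_

  _then_ : Within G j x y → Within G k y u → Within G (j + k) x u
  (_ , i≤j , p) then (_ , l≤k , q) = _ , +-mono-≤ i≤j l≤k , p ++ʷ q

  -- The free bound pads a sum of lengths up to the bound required.
  stay : Within G k x x
  stay = 0 , z≤n , nil

  step : Adj G x y → Within G 1 x y
  step a = 1 , ≤-refl , cons a nil

  step⁻ : Adj G x y → Within G 1 y x
  step⁻ a = step (sym G a)

  step₃ : Adj G x y → Within G 3 x y
  step₃ a = step a then stay

  within-sym : Symmetric (Within G k)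
  within-sym (_ , i≤k , p) = _ , i≤k , reverseWalk p

  power-path : Unique (x ∷ X) → y ∉ x ∷ X → Path (Within G k) x X y → Path (Adj (power G k)) x X y
  power-path uniq y∉ p = mapPath
    (λ { (x≢y , _ , i≤k , q) → let l , dist , l≤i = walk-distance q in x≢y , l , dist , ≤-trans l≤i i≤k })
    (path-distinct uniq y∉ p)

  -- Strands: paths with steps of length at most 3 and open ends.

  relax : Path (Adj G) x X y → Path (Within G 3) x X y
  relax = mapPath step₃

  -- The last step of a path may be redirected, which keeps the interior.
  continue : Path (Adj G) x X y →
    ∃[ z ] (Adj G z y × (∀ {P v} → Path (Within G 3) z P v → Path (Within G 3) x (X ++ P) v))
  continue (edge a) = _ , a , λ p → p
  continue (a ∷ p)  = let z , zy , ext = continue p in z , zy , λ q → step₃ a ∷ ext q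

  -- The target is left open among the neighbours of `w`, so that the strand can pass over `w` into
  -- the next stretch.
  Exit : Fin n → List (Fin n) → Fin n → Set
  Exit u P w = ∀ {z} → Adj G w z → Path (Within G 3) u P z

  leave : Exit u P w → Path (Adj G) w X y → Path (Within G 3) u (P ++ X) y
  leave {P = P} exit (edge a) = subst (λ X → Path _ _ X _) (≡-sym (++-identityʳ P)) (exit a)
  leave exit (a ∷ p) = exit a ▹ relax p

  -- A path to w whose first vertex is near u and whose start is left open.
  data Entry (u : Fin n) : List (Fin n) → Fin n → Set where
    direct : Within G 1 u w → Entry u [] w
    via    : Within G 1 u x → Path (Within G 3) x P w → Entry u (x ∷ P) w

  enter : Within G 2 x u → Entry u P w → Path (Within G 3) x P w
  enter xu (direct uw) = edge (xu then uw)
  enter xu (via uy p)  = (xu then uy) ∷ p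

  -- The strand to be closed at w and the strand to be continued beyond w
  -- depend on the length of the path modulo 3.
  weave : Within G 1 v u → Path (Adj G) u X w →
    ∃[ P ] ∃[ Q ] ∃[ R ] (P ++ Q ++ R ↭ X × Entry u P w ×
      (Path (Within G 3) v Q w × Exit u R w ⊎ Exit v Q w × Path (Within G 3) u R w))
  weave vu (edge uw) = [] , [] , [] , ↭-refl , direct (step uw) ,
    inj₁ (edge (vu then step uw then stay) , λ wz → edge (step uw then step wz then stay))
  weave vu (ux ∷ edge xw) = _ ∷ [] , [] , [] , ↭-refl , via (step ux) (edge (step₃ xw)) ,
    inj₁ (edge (vu then step ux then step xw) , λ wz → edge (step ux then step xw then step wz))
  -- From `u` the vertex `w` is already 3 steps away, so this strand must close there, and the one
  -- through `y` goes on.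
  weave vu (ux ∷ xy ∷ edge yw) =
    _ ∷ [] , _ ∷ [] , [] , ↭-refl , via (step ux) (edge (step xy then step yw then stay)) ,
    inj₂ ((λ wz → (vu then step ux then step xy) ∷ edge (step yw then step wz then stay)) ,
          edge (step ux then step xy then step yw))
  -- Each strand takes one vertex. Next, `y` and `z` replace `v` and `u`; the remaining entry begins
  -- within 1 of `z`, hence within 3 of `x`.
  weave {v = v} {u = u} vu (_∷_ {v = x} ux (_∷_ {v = y} xy (_∷_ {v = z} yz p)))
    with P , Q , R , PQR↭X , entry , strands ← weave (step yz) p =
    x ∷ P , y ∷ Q , z ∷ R ,
    prep x (↭-trans (shift y P (Q ++ z ∷ R)) (prep y (↭-trans
      (++⁺ˡ P (shift z Q R)) (↭-trans (shift z P (Q ++ R)) (prep z PQR↭X))))) ,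
    via (step ux) (enter (step xy then step yz) entry) , extend strands
    where
    vy : Within G 3 v y
    vy = vu then step ux then step xy
    uz : Within G 3 u z
    uz = step ux then step xy then step yz
    extend : Path (Within G 3) y Q _ × Exit z R _ ⊎ Exit y Q _ × Path (Within G 3) z R _ →
             Path (Within G 3) v (y ∷ Q) _ × Exit u (z ∷ R) _ ⊎ Exit v (y ∷ Q) _ × Path (Within G 3) u (z ∷ R) _
    extend (inj₁ (q , r)) = inj₁ (vy ∷ q , λ wz → uz ∷ r wz)
    extend (inj₂ (q , r)) = inj₂ ((λ wz → vy ∷ q wz) , uz ∷ r)

  -- Both lower strands of `weave` start at `u` here. The one closed at `w` is reversed into the way
  -- back, and the other then leaves `u` past `w`.
  crossThrice : Path (Adj G) u X w →
    ∃[ P ] ∃[ Q ] ∃[ R ] (P ++ Q ++ R ↭ X × Entry u P w × Path (Within G 3) w Q u × Exit u R w)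
  crossThrice p with weave stay p
  ... | P , Q , R , PQR↭X , entry , inj₁ (q , r) =
    let Q′ , Q′↭Q , q′ = backwards within-sym q in
    P , Q′ , R , ↭-trans (++⁺ˡ P (++⁺ʳ R Q′↭Q)) PQR↭X , entry , q′ , r
  ... | P , Q , R , PQR↭X , entry , inj₂ (q , r) =
    let R′ , R′↭R , r′ = backwards within-sym r in
    P , R′ , Q , ↭-trans (++⁺ˡ P (↭-trans (++-comm R′ Q) (++⁺ˡ Q R′↭R))) PQR↭X , entry , r′ , q

  -- The first entry is run in reverse, then the stretch, then the second entry. Both begin within 1
  -- of `u` or `v`, so a stretch without interior is jumped in a single step.
  bridge : Entry u P x → Path (Adj G) u X v → Entry v Q y →
    ∃[ Z ] (Z ↭ P ++ X ++ Q × Path (Within G 3) x Z y)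
  bridge (direct ux) (edge uv) entry = _ , ↭-refl , enter (within-sym ux then step uv) entry
  bridge {Q = Q} (via {x = z} uz p) (edge uv) entry =
    let P′ , P′↭P , p′ = backwards within-sym p in
    P′ ++ z ∷ Q , ↭-trans (shift z P′ Q) (prep z (++⁺ʳ Q P′↭P)) ,
    p′ ▹ enter (within-sym uz then step uv) entry
  bridge {P = P} {Q = Q} entry′ (_∷_ {v = z} {X = X} uz p) entry =
    let P′ , P′↭P , p′ = backwards within-sym (enter (step⁻ uz then stay) entry′)
        _ , ev , ext = continue p in
    P′ ++ z ∷ X ++ Q , ++⁺ʳ (z ∷ X ++ Q) P′↭P , p′ ▹ ext (enter (step ev then stay) entry)

  -- One lap sets out from `u` and runs past `v`; the other comes in past `u` and stops at `v`.
  twoStrands : Path (Adj G) u X v →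
    ∃[ P ] ∃[ Q ] (P ++ Q ↭ X ×
      (∃[ z ] (Adj G z v × (∀ {Y w} → Path (Within G 3) z Y w → Path (Within G 3) u (P ++ Y) w))) ×
      (∀ {z} → Adj G z u → Path (Within G 3) z Q v))
  twoStrands (edge uv) = [] , [] , ↭-refl , (_ , uv , λ q → q) ,
    λ zu → edge (step zu then step uv then stay)
  twoStrands (ux ∷ edge xv) = _ ∷ [] , [] , ↭-refl , (_ , xv , λ q → step₃ ux ∷ q) ,
    λ zu → edge (step zu then step ux then step xv)
  -- The first strand resumes at `y`, and `x` is the neighbour of `y` from which the second arrives.
  twoStrands (_∷_ {v = x} ux (_∷_ {v = y} xy p)) =
    let P , Q , PQ↭X , (z , zv , ext) , other = twoStrands p in
    y ∷ P , x ∷ Q , ↭-trans (prep y (shift x P Q)) (swap y x PQ↭X) ,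
    (z , zv , λ q → (step ux then step xy then stay) ∷ ext q) ,
    λ zu → (step zu then step ux then stay) ∷ other xy

  -- The four cyclic orders and the reduction to them.

  open CommutativeMonoidSolver (++-commutativeMonoid {A = Fin n})
  open PermutationReasoning

  relaxTour : Tour (Adj G) I a b c d e → Tour (Within G 3) I a b c d e
  relaxTour (tour p q r s t i) = tour (relax p) (relax q) (relax r) (relax s) (relax t) i

  -- The path arriving at `d` has its last step redirected into the entry to `e`; `d` is met on the
  -- way back, and the third crossing passes `e` towards `a`.
  transpose : Tour (Adj G) I a b c d e → Tour (Within G 3) I a b c e d
  transpose (tour {A} {B} {C} {D} {E} p q r s t i)
    with _ , zd , ext ← continue r
       | P , Q , R , PQR↭D , entry , back , exit ← crossThrice s
    = tour (relax p) (relax q) (ext (enter (step zd then stay) entry)) back (leave exit t) (begin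
        A ++ B ++ (C ++ P) ++ Q ++ R ++ E
          ↭⟨ solve 7 (λ A B C P Q R E → A ⊕ B ⊕ (C ⊕ P) ⊕ Q ⊕ R ⊕ E ⊜ A ⊕ B ⊕ C ⊕ (P ⊕ Q ⊕ R) ⊕ E) ↭-refl A B C P Q R E ⟩
        A ++ B ++ C ++ (P ++ Q ++ R) ++ E
          ↭⟨ ++⁺ˡ A (++⁺ˡ B (++⁺ˡ C (++⁺ʳ E PQR↭D))) ⟩
        A ++ B ++ C ++ D ++ E
          ↭⟨ i ⟩
        _ ∎)

  -- The stretch from a to b is crossed in the mirrored way, because a bridge
  -- needs entries at both ends.
  transpose² : Tour (Adj G) I a b c d e → Tour (Within G 3) I b a d c e
  transpose² (tour {A} {B} {C} {D} {E} p q r s t i)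
    with A′ , A′↭A , p′ ← backwards (sym G) p
       | E′ , E′↭E , t′ ← backwards (sym G) t
    with P , Q , R , PQR↭A′ , entry , back , exit ← crossThrice p′
       | P₁ , Q₁ , R₁ , PQR↭C , entry₁ , back₁ , exit₁ ← crossThrice r
    with Q′ , Q′↭Q , back′ ← backwards within-sym back
       | Z , Z↭ , z ← bridge entry q entry₁
       | Y , Y↭ , y ← backwards within-sym (leave exit t′)
    = tour back′ z back₁ (leave exit₁ s) y (begin
        Q′ ++ Z ++ Q₁ ++ (R₁ ++ D) ++ Y
          ↭⟨ ++⁺ Q′↭Q (++⁺ Z↭ (++⁺ˡ Q₁ (++⁺ˡ (R₁ ++ D) Y↭))) ⟩
        Q ++ (P ++ B ++ P₁) ++ Q₁ ++ (R₁ ++ D) ++ R ++ E′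
          ↭⟨ solve 9 (λ P Q R P₁ Q₁ R₁ B D E →
               Q ⊕ (P ⊕ B ⊕ P₁) ⊕ Q₁ ⊕ (R₁ ⊕ D) ⊕ R ⊕ E ⊜ (P ⊕ Q ⊕ R) ⊕ B ⊕ (P₁ ⊕ Q₁ ⊕ R₁) ⊕ D ⊕ E)
               ↭-refl P Q R P₁ Q₁ R₁ B D E′ ⟩
        (P ++ Q ++ R) ++ B ++ (P₁ ++ Q₁ ++ R₁) ++ D ++ E′
          ↭⟨ ++⁺ (↭-trans PQR↭A′ A′↭A) (++⁺ˡ B (++⁺ PQR↭C (++⁺ˡ D E′↭E))) ⟩
        A ++ B ++ C ++ D ++ E
          ↭⟨ i ⟩
        _ ∎)

  -- Each leg is the first strand of one stretch followed by the second strand of the next, passing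
  -- over the prescribed vertex between them.
  pentagram : Tour (Adj G) I a b c d e → Tour (Within G 3) I a c e b d
  pentagram (tour {A} {B} {C} {D} {E} p q r s t i)
    with P₁ , Q₁ , A↭ , (_ , zb , ext₁) , other₁ ← twoStrands p
       | P₂ , Q₂ , B↭ , (_ , zc , ext₂) , other₂ ← twoStrands q
       | P₃ , Q₃ , C↭ , (_ , zd , ext₃) , other₃ ← twoStrands r
       | P₄ , Q₄ , D↭ , (_ , ze , ext₄) , other₄ ← twoStrands s
       | P₅ , Q₅ , E↭ , (_ , za , ext₅) , other₅ ← twoStrands t
    = tour (ext₁ (other₂ zb)) (ext₃ (other₄ zd)) (ext₅ (other₁ za)) (ext₂ (other₃ zc)) (ext₄ (other₅ ze)) (begin
        (P₁ ++ Q₂) ++ (P₃ ++ Q₄) ++ (P₅ ++ Q₁) ++ (P₂ ++ Q₃) ++ P₄ ++ Q₅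
          ↭⟨ solve 10 (λ P₁ P₂ P₃ P₄ P₅ Q₁ Q₂ Q₃ Q₄ Q₅ →
                 (P₁ ⊕ Q₂) ⊕ (P₃ ⊕ Q₄) ⊕ (P₅ ⊕ Q₁) ⊕ (P₂ ⊕ Q₃) ⊕ P₄ ⊕ Q₅
               ⊜ (P₁ ⊕ Q₁) ⊕ (P₂ ⊕ Q₂) ⊕ (P₃ ⊕ Q₃) ⊕ (P₄ ⊕ Q₄) ⊕ P₅ ⊕ Q₅)
               ↭-refl P₁ P₂ P₃ P₄ P₅ Q₁ Q₂ Q₃ Q₄ Q₅ ⟩
        (P₁ ++ Q₁) ++ (P₂ ++ Q₂) ++ (P₃ ++ Q₃) ++ (P₄ ++ Q₄) ++ P₅ ++ Q₅
          ↭⟨ ++⁺ A↭ (++⁺ B↭ (++⁺ C↭ (++⁺ D↭ E↭))) ⟩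
        A ++ B ++ C ++ D ++ E
          ↭⟨ i ⟩
        _ ∎)

  -- The indices run over the 24 orders of `b`, `c`, `d`, `e`. Rotating before, and rotating or
  -- mirroring after, reduces 2 of them to `relaxTour`, 10 to `transpose`, 10 to `transpose²` and 2
  -- to `pentagram`.
  reorder : ∀ i j k → Route (Adj G) I a (insertAt (insertAt (insertAt (e ∷ []) i d) j c) k b) a →
            Tour (Within G 3) I a b c d e
  reorder 0F 0F 0F r = relaxTour (route⇒tour r)
  reorder 0F 0F 1F r = rotate² (transpose (rotate³ (route⇒tour r)))
  reorder 0F 0F 2F r = mirror within-sym (transpose² (rotate⁴ (route⇒tour r)))
  reorder 0F 0F 3F r = rotate³ (transpose (rotate (route⇒tour r)))
  reorder 0F 1F 0F r = rotate (transpose (rotate⁴ (route⇒tour r)))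
  reorder 0F 1F 1F r = mirror within-sym (rotate² (transpose² (rotate² (route⇒tour r))))
  reorder 0F 1F 2F r = mirror within-sym (rotate³ (transpose (rotate (route⇒tour r))))
  reorder 0F 1F 3F r = transpose² (rotate⁴ (route⇒tour r))
  reorder 0F 2F 0F r = mirror within-sym (rotate (transpose² (route⇒tour r)))
  reorder 0F 2F 1F r = pentagram (route⇒tour r)
  reorder 0F 2F 2F r = mirror within-sym (rotate⁴ (transpose² (rotate (route⇒tour r))))
  reorder 0F 2F 3F r = mirror within-sym (rotate² (transpose (rotate³ (route⇒tour r))))
  reorder 1F 0F 0F r = transpose (route⇒tour r)
  reorder 1F 0F 1F r = rotate⁴ (transpose² (rotate (route⇒tour r)))
  reorder 1F 0F 2F r = mirror within-sym (pentagram (route⇒tour r))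
  reorder 1F 0F 3F r = rotate² (transpose² (rotate² (route⇒tour r)))
  reorder 1F 1F 0F r = mirror within-sym (rotate³ (transpose² (rotate³ (route⇒tour r))))
  reorder 1F 1F 1F r = rotate⁴ (transpose (rotate² (route⇒tour r)))
  reorder 1F 1F 2F r = rotate (transpose² (route⇒tour r))
  reorder 1F 1F 3F r = mirror within-sym (rotate (transpose (rotate⁴ (route⇒tour r))))
  reorder 1F 2F 0F r = mirror within-sym (rotate⁴ (transpose (rotate² (route⇒tour r))))
  reorder 1F 2F 1F r = rotate³ (transpose² (rotate³ (route⇒tour r)))
  reorder 1F 2F 2F r = mirror within-sym (transpose (route⇒tour r))
  reorder 1F 2F 3F r = mirror within-sym (relaxTour (route⇒tour r))

  -- Passing between Hamiltonian cycles and closed paths.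

  fromVertex : ∀ v → Hamiltonian G →
    ∃[ X ] (Unique (v ∷ X) × (∀ u → u ∈ v ∷ X) × Path (Adj G) v X v)
  fromVertex v (z , X , cycle , spans) with spans v
  ... | here refl = X , IsCycle.distinct cycle , spans , linked⇒path X (IsCycle.closed cycle)
  ... | there v∈X with Y , Z , refl ← ∈-∃++ v∈X =
    let p , q = splitPath Y (linked⇒path (Y ++ v ∷ Z) (IsCycle.closed cycle))
        rotated : z ∷ Y ++ v ∷ Z ↭ v ∷ Z ++ z ∷ Y
        rotated = ++-comm (z ∷ Y) (v ∷ Z)
    in Z ++ z ∷ Y , unique-↭ rotated (IsCycle.distinct cycle) ,
       (λ u → ∈-resp-↭ rotated (spans u)) , q ▹ p

  path⇒hamiltonianCycle : Unique (u ∷ X) → (∀ v → v ∈ u ∷ X) → 2 ≤ length X →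
    Path (Within G k) u X u → IsHamiltonianCycle (power G k) u X
  path⇒hamiltonianCycle uniq@(u∉X ∷ uniqX) spans long (_∷_ {v = x} ux p) =
    record { long = s≤s long ; distinct = uniq ; closed = path⇒linked powered } , spans
    where
    powered : Path (Adj (power G _)) _ _ _
    -- A closed path ends where it starts, but `power-path` needs an end off the path; hence the
    -- first edge is treated apart.
    powered with edge a ← power-path ([] ∷ []) (λ { (here refl) → All¬⇒¬Any u∉X (here refl) }) (edge ux)
      = a ∷ power-path uniqX (All¬⇒¬Any u∉X) p
  path⇒hamiltonianCycle _ _ () (edge _)

corollary6p2 : (n : ℕ) → 5 ≤ n → (G : Graph n) → Hamiltonian G → OrderedHamiltonian 5 (power G 3)
corollary6p2 n _ G ham v₁ (v₂ ∷ v₃ ∷ v₄ ∷ v₅ ∷ []) refl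
  ((v₁≢v₂ ∷ v₁≢v₃ ∷ v₁≢v₄ ∷ v₁≢v₅ ∷ []) ∷ v₂∉ ∷ v₃∉ ∷ v₄∉ ∷ _)
  with X , uniq , spans , p ← fromVertex v₁ ham
  -- Starting from `v₅` alone, `v₄`, `v₃` and `v₂` are inserted in turn.
  with i , s ← insertAt-⊆ (∈-tail (spans v₄) v₁≢v₄) (All¬⇒¬Any v₄∉) (from∈ (∈-tail (spans v₅) v₁≢v₅))
  with j , s ← insertAt-⊆ (∈-tail (spans v₃) v₁≢v₃)
                 (λ v₃∈ → All¬⇒¬Any v₃∉ (∈-resp-↭ (insertAt-↭ _ i v₄) v₃∈)) s
  with ↭₃₄₅ ← ↭-trans (insertAt-↭ _ j v₃) (prep v₃ (insertAt-↭ (v₅ ∷ []) i v₄))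
  with k , s ← insertAt-⊆ (∈-tail (spans v₂) v₁≢v₂) (λ v₂∈ → All¬⇒¬Any v₂∉ (∈-resp-↭ ↭₃₄₅ v₂∈)) s
  with I , X↭ , r ← route p s
  with Y , Y↭ , s′ , q ← tour⇒path (reorder i j k r)
  = let X↭Y = prep v₁ (↭-trans X↭ (↭-trans (++⁺ʳ I (↭-trans (insertAt-↭ _ k v₂) (prep v₂ ↭₃₄₅))) (↭-sym Y↭)))
    in Y , path⇒hamiltonianCycle (unique-↭ X↭Y uniq) (λ u → ∈-resp-↭ X↭Y (spans u))
             (≤-trans (s≤s (s≤s z≤n)) (length-mono-≤ s′)) q , s′
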